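{- There is a direct-first deterministic online algorithm for $\mathrm{OMP}_3(1,2)$ whose competitive ratio is at most $5/8$. In particular, the direct-first property alone does not imply the guarantee $\gamma_2=7/11$.
   Context: Online bipartite matching: an instance $(G,\pi)$ is a finite bipartite graph $G=(L,R,E)$ and an arrival order $\pi$ of $R$. The offline side $L$ is known in advance; online vertices $j\in R$ arrive one by one in order $\pi$, and upon arrival of $j$ all edges incident to $j$ are revealed. The algorithm maintains a matching $M$, initially empty. A vertex is free if it is currently unmatched. $\mathrm{OMP}_3(s,t)$: upon arrival of $j$, the algorithm either leaves $j$ unmatched (forever, unless matched at this moment) or augments the current matching along an augmenting path of length $1$ or $3$ that starts at $j$ and ends at a free vertex of $L$. A length-1 path $[j~i]$ adds $ji$ with $i\in L$ free. A length-3 path $[j~x~y~i]$, with $x,i\in L$, $y\in R$, $xy\in M$, $i$ free, $jx,yi\in E$, replaces $M$ by $(M\setminus\{xy\})\cup\{jx,yi\}$; then $x$ and $y$ are each said to be reassigned once. Over the execution, each vertex of $L$ may be reassigned at most $s$ times and each vertex of $R$ at most $t$ times. An augmentation is feasible if every vertex it would reassign has not yet reached its budget. An algorithm is SP-Greedy if, upon each arrival $j$, it augments along some feasible path of length 1 or 3 starting at $j$ whenever such a path exists, and otherwise leaves $j$ unmatched. It is direct-first if it is SP-Greedy and uses a length-1 augmentation (direct match) whenever one is available. The competitive ratio of an algorithm is the supremum of $\rho$ such that on every instance $(G,\pi)$ its output matching has size at least $\rho\cdot\nu(G)$, with $\nu(G)$ the maximum matching size of $G$. Here $\gamma_t=\frac{2\cdot2^t-1}{3\cdot2^t-1}$.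 -}

module Defs where

open import Data.Fin using (Fin; inject₁; fromℕ)
open import Data.Fin.Permutation using (Permutation′; _⟨$⟩ʳ_)
import Data.Fin.Properties as Fin
open import Data.Fin.Subset using (Subset; _∈_)
open import Data.Integer using (+_)
open import Data.List using (List; []; _∷_; map; filter; length)
import Data.List.Membership.Propositional as List
open import Data.List.Relation.Unary.All using (All)
open import Data.List.Relation.Unary.Unique.Propositional using (Unique)
open import Data.Maybe using (Maybe; just; nothing; Is-just)
open import Data.Nat using (ℕ; zero; suc; _*_; _∸_; _^_; _≤_; _<_; NonZero; >-nonZero; z<s; s<s)
open import Data.Nat.Properties using (m<n⇒0<n∸m; m^n>0; <-≤-trans; *-monoʳ-≤)
open import Data.Product using (_×_; _,_; ∃; proj₁; proj₂; map₂)
open import Data.Product.Properties using (≡-dec)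
open import Data.Rational as ℚ using (ℚ; _/_)
open import Data.Vec.Functional using (Vector; init; last; insertAt; updateAt; replicate)
open import Function using (_∘_)
open import Relation.Binary.PropositionalEquality using (_≡_)
open import Relation.Nullary using (¬_; ¬?)

private
  variable
    l r s t : ℕ

-- A finite bipartite graph with L = Fin l and R = Fin r, given by the
-- neighbourhood of each vertex of R: i and j are adjacent iff i ∈ G j.

Graph : ℕ → ℕ → Set
Graph l r = Vector (Subset l) r

-- A list stands for the set of its elements; IsMatching excludes repetitions,
-- so the length of a matching is its size.

Edges : ℕ → ℕ → Set
Edges l r = List (Fin l × Fin r)

IsMatching : Graph l r → Edges l r → Set
IsMatching G M =
  All (λ (i , j) → i ∈ G j) M × Unique (map proj₁ M) × Unique (map proj₂ M)

IsMaximumMatchingSize : Graph l r → ℕ → Set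
IsMaximumMatchingSize G n =
  (∃ λ M → IsMatching G M × length M ≡ n) ×
  (∀ M → IsMatching G M → length M ≤ n)

record Config (l r : ℕ) : Set where
  constructor config
  field
    matching    : Edges l r
    reassignedL : Vector ℕ l
    reassignedR : Vector ℕ r

open Config public

Free : Config l r → Fin l → Set
Free c i = ¬ (i List.∈ map proj₁ (matching c))

-- Augmenting paths from an implicit starting vertex j ∈ R:
-- direct i is [j i] and via x y i is [j x y i].

data Path (l r : ℕ) : Set where
  direct : (i : Fin l) → Path l r
  via    : (x : Fin l) (y : Fin r) (i : Fin l) → Path l r

-- Feasible s t G c j p: p is an augmenting path from j ending at a free vertex
-- of L, and augmenting along it respects the budgets s (on L) and t (on R).

Feasible : (s t : ℕ) → Graph l r → Config l r → Fin r → Path l r → Set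
Feasible s t G c j (direct i)  = i ∈ G j × Free c i
Feasible s t G c j (via x y i) =
  x ∈ G j × (x , y) List.∈ matching c × i ∈ G y × Free c i ×
  reassignedL c x < s × reassignedR c y < t

augment : Config l r → Fin r → Path l r → Config l r
augment c j (direct i)  = record c { matching = (i , j) ∷ matching c }
augment c j (via x y i) = record
  { matching    = (x , j) ∷ (i , y) ∷ filter (λ e → ¬? (≡-dec Fin._≟_ Fin._≟_ e (x , y))) (matching c)
  ; reassignedL = updateAt (reassignedL c) x suc
  ; reassignedR = updateAt (reassignedR c) y suc
  }

-- Online vertices are named by their arrival times: after r arrivals the
-- revealed graph is a Graph l r, earlier vertices being renamed by inject₁ and
-- the newest one being fromℕ.

arrive : Config l r → Config l (suc r)
arrive (config M cL cR) =
  config (map (map₂ inject₁) M) cL (insertAt cR (fromℕ _) 0)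

-- A deterministic online algorithm for OMP₃(s,t). When the (k+1)-st online
-- vertex arrives, it sees L, the graph revealed so far and the current
-- configuration (in particular neither the number of online vertices nor any
-- later neighbourhood), and selects a feasible augmentation, or nothing,
-- which leaves the vertex unmatched.

Algorithm : (s t : ℕ) → Set
Algorithm s t =
  (l k : ℕ) (G : Graph l (suc k)) (c : Config l (suc k)) →
  Maybe (∃ (Feasible s t G c (fromℕ k)))

apply : {G : Graph l r} (c : Config l r) (j : Fin r) →
        Maybe (∃ (Feasible s t G c j)) → Config l r
apply c j nothing        = c
apply c j (just (p , _)) = augment c j p

run : Algorithm s t → Graph l r → Config l r

-- The configuration in which the algorithm decides about the last vertex of G.

before : {k : ℕ} → Algorithm s t → Graph l (suc k) → Config l (suc k)
before A G = arrive (run A (init G))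

run {r = zero}  A G = config [] (replicate _ 0) (replicate _ 0)
run {r = suc k} A G = apply (before A G) (fromℕ k) (A _ k G (before A G))

-- Every arrival in every instance is the last arrival of some prefix G. The
-- algorithm can select only feasible paths, so it leaves a vertex unmatched
-- when there is none.

SPGreedy : Algorithm s t → Set
SPGreedy {s} {t} A =
  ∀ {l k} (G : Graph l (suc k)) →
  ∃ (Feasible s t G (before A G) (fromℕ k)) →
  Is-just (A l k G (before A G))

DirectFirst : Algorithm s t → Set
DirectFirst {s} {t} A =
  SPGreedy A ×
  (∀ {l k} (G : Graph l (suc k)) →
   (∃ λ i → Feasible s t G (before A G) (fromℕ k) (direct i)) →
   ∃ λ i → ∃ λ f → A l k G (before A G) ≡ just (direct i , f))

-- The instance (G , π), where π sends arrival times to vertices of R.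

arrivals : Graph l r → Permutation′ r → Graph l r
arrivals G π k = G (π ⟨$⟩ʳ k)

Guarantees : Algorithm s t → ℚ → Set
Guarantees A ρ =
  ∀ {l r} (G : Graph l r) (π : Permutation′ r) (ν : ℕ) →
  IsMaximumMatchingSize G ν →
  ρ ℚ.* (+ ν / 1) ℚ.≤ + length (matching (run A (arrivals G π))) / 1

-- The competitive ratio is the supremum of the guaranteed ρ, so it is at most b
-- iff b bounds them all. Rational ρ suffice: the set of guaranteed real ρ is
-- downward closed, so it has the same supremum as its rational part.

CompetitiveRatioAtMost : Algorithm s t → ℚ → Set
CompetitiveRatioAtMost A b = ∀ ρ → Guarantees A ρ → ρ ℚ.≤ b

3*2^t∸1-nonZero : ∀ t → NonZero (3 * 2 ^ t ∸ 1)
3*2^t∸1-nonZero t =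
  >-nonZero (m<n⇒0<n∸m (<-≤-trans (s<s z<s) (*-monoʳ-≤ 3 (m^n>0 2 t))))

γ : ℕ → ℚ
γ t = + (2 * 2 ^ t ∸ 1) / (3 * 2 ^ t ∸ 1)
  where instance _ = 3*2^t∸1-nonZero t

{-# OPTIONS --safe #-}

-- Write iₖ and jₖ for the offline and online vertices, and let the algorithm
-- take the lexicographically first direct match or else the lexicographically
-- first path of length 3. On the instance below, j₀ and j₁ take i₃ and i₄
-- instead of i₅ and i₆, and j₂ takes i₀. Then j₃ and j₄ push j₂ on to i₁ and to
-- i₂, which uses up the budgets of i₀, i₁ and j₂. Hence i₀, i₁ and i₂ cannot be
-- released any more, and j₅, j₆, j₇, which have no other neighbours, stay
-- unmatched. So 5 vertices are matched although there is a perfect matching.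

module Submission where

open import Defs
open import Data.Fin using (Fin; zero; suc; fromℕ)
open import Data.Fin.Patterns
open import Data.Fin.Permutation using () renaming (id to idₚ)
import Data.Fin.Properties as Fin
open import Data.Fin.Subset using (⁅_⁆; _∪_)
open import Data.Fin.Subset.Properties using (_∈?_)
open import Data.Integer using (+_)
open import Data.List using (List; []; _∷_; length; lookup; map)
import Data.List.Membership.DecPropositional as DecMembership
open import Data.List.Membership.Propositional.Properties using (∈-lookup)
import Data.List.Relation.Unary.All as All
open import Data.List.Relation.Unary.AllPairs using (_∷_)
open import Data.List.Relation.Unary.Unique.Propositional using (Unique)
import Data.List.Relation.Unary.Unique.DecPropositional as DecUnique
open import Data.List.Properties using (length-map)
open import Data.Maybe using (Maybe; just; nothing; Is-just)
open import Data.Maybe.Relation.Unary.Any using (just)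
open import Data.Nat using (ℕ; suc; _≤_; _<?_)
open import Data.Product using (_×_; ∃; _,_; proj₁; proj₂)
open import Data.Product.Properties using (≡-dec)
open import Data.Rational using (_/_)
import Data.Rational as ℚ
import Data.Rational.Properties as ℚ
open import Data.Vec using ([]; _∷_)
import Data.Vec as Vec
open import Relation.Binary.PropositionalEquality using (_≡_; refl; cong; subst; sym)
open import Relation.Nullary using (¬_; Dec; yes; no; ¬?; contradiction)
open import Relation.Nullary.Decidable using (_×-dec_; from-yes; from-no)

private
  variable
    l r s t : ℕ

free? : (c : Config l r) (i : Fin l) → Dec (Free c i)
free? c i = ¬? (i ∈ˡ? map proj₁ (matching c))
  where open DecMembership Fin._≟_ renaming (_∈?_ to _∈ˡ?_)

feasible? : ∀ s t (G : Graph l r) c j p → Dec (Feasible s t G c j p)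
feasible? s t G c j (direct i)  = (i ∈? G j) ×-dec free? c i
feasible? s t G c j (via x y i) =
  (x ∈? G j) ×-dec ((x , y) ∈ˡ? matching c) ×-dec (i ∈? G y) ×-dec free? c i ×-dec
  (reassignedL c x <? s) ×-dec (reassignedR c y <? t)
  where open DecMembership (≡-dec Fin._≟_ Fin._≟_) renaming (_∈?_ to _∈ˡ?_)

DirectPath ViaPath : (s t : ℕ) → Graph l r → Config l r → Fin r → Set
DirectPath s t G c j = ∃ λ i → Feasible s t G c j (direct i)
ViaPath    s t G c j = ∃ λ x → ∃ λ y → ∃ λ i → Feasible s t G c j (via x y i)

-- `Fin.any?` returns the least witness; nested as in `viaPath?`, it makes the triple (x, y, i)
-- lexicographically first.
directPath? : ∀ s t (G : Graph l r) c j → Dec (DirectPath s t G c j)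
directPath? s t G c j = Fin.any? λ i → feasible? s t G c j (direct i)

viaPath? : ∀ s t (G : Graph l r) c j → Dec (ViaPath s t G c j)
viaPath? s t G c j =
  Fin.any? λ x → Fin.any? λ y → Fin.any? λ i → feasible? s t G c j (via x y i)

module _ {G : Graph l r} {c : Config l r} {j : Fin r} where

  -- The decisions are arguments, so that the two properties below follow by matching on them,
  -- whatever the configuration.
  select : Dec (DirectPath s t G c j) → Dec (ViaPath s t G c j) →
           Maybe (∃ (Feasible s t G c j))
  select (yes (i , f)) _                     = just (direct i , f)
  select (no _)        (yes (x , y , i , f)) = just (via x y i , f)
  select (no _)        (no _)                = nothing

  select-greedy : (d : Dec (DirectPath s t G c j)) (v : Dec (ViaPath s t G c j)) →
                  ∃ (Feasible s t G c j) → Is-just (select d v)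
  select-greedy (yes _) _       _               = just _
  select-greedy (no _)  (yes _) _               = just _
  select-greedy (no ¬d) (no _)  (direct i , f)  = contradiction (i , f) ¬d
  select-greedy (no _)  (no ¬v) (via x y i , f) = contradiction (x , y , i , f) ¬v

  select-directFirst : (d : Dec (DirectPath s t G c j)) (v : Dec (ViaPath s t G c j)) →
                       DirectPath s t G c j →
                       ∃ λ i → ∃ λ f → select d v ≡ just (direct i , f)
  select-directFirst (yes (i , f)) _ _ = i , f , refl
  select-directFirst (no ¬d)       _ d = contradiction d ¬d

lexicographic : Algorithm s t
lexicographic {s} {t} l k G c =
  select (directPath? s t G c (fromℕ k)) (viaPath? s t G c (fromℕ k))

lexicographic-directFirst : DirectFirst (lexicographic {s} {t})
lexicographic-directFirst {s} {t} =
  (λ G → select-greedy (decideDirect G) (decideVia G)) ,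
  (λ G → select-directFirst (decideDirect G) (decideVia G))
  where
  A : Algorithm s t
  A = lexicographic

  decideDirect : ∀ {k} (G : Graph l (suc k)) → Dec (DirectPath s t G (before A G) (fromℕ k))
  decideDirect G = directPath? s t G (before A G) (fromℕ _)

  decideVia : ∀ {k} (G : Graph l (suc k)) → Dec (ViaPath s t G (before A G) (fromℕ k))
  decideVia G = viaPath? s t G (before A G) (fromℕ _)

lookup-injective : ∀ {a} {A : Set a} {xs : List A} → Unique xs →
                   ∀ i j → lookup xs i ≡ lookup xs j → i ≡ j
lookup-injective (_ ∷ _)   zero    zero    _  = refl
lookup-injective (x≢ ∷ _)  zero    (suc j) eq = contradiction eq (All.lookup x≢ (∈-lookup j))
lookup-injective (x≢ ∷ _)  (suc i) zero    eq = contradiction (sym eq) (All.lookup x≢ (∈-lookup i))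
lookup-injective (_ ∷ xs!) (suc i) (suc j) eq = cong suc (lookup-injective xs! i j eq)

-- Pigeonhole: the L-endpoints are distinct, so looking them up by position injects `Fin (length M)`
-- into `Fin l`.
matching-size≤l : (G : Graph l r) (M : Edges l r) → IsMatching G M → length M ≤ l
matching-size≤l G M (_ , unique , _) =
  subst (_≤ _) (length-map proj₁ M)
    (Fin.injective⇒≤ λ {i} {j} → lookup-injective unique i j)

-- The labels steer the rule into the bad choices: i₃ precedes i₅, i₄ precedes i₆, and i₇ is the
-- last neighbour of j₂. For j₃ and j₄, i₀ precedes i₃ and i₁ precedes i₄, so the paths that would
-- move j₀ to i₅ and j₁ to i₆ are passed over.
hard : Graph 8 8
hard = Vec.lookup
  ( ⁅ 3F ⁆ ∪ ⁅ 5F ⁆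
  ∷ ⁅ 4F ⁆ ∪ ⁅ 6F ⁆
  ∷ ⁅ 0F ⁆ ∪ ⁅ 1F ⁆ ∪ ⁅ 2F ⁆ ∪ ⁅ 7F ⁆
  ∷ ⁅ 0F ⁆ ∪ ⁅ 3F ⁆
  ∷ ⁅ 1F ⁆ ∪ ⁅ 4F ⁆
  ∷ ⁅ 0F ⁆
  ∷ ⁅ 1F ⁆
  ∷ ⁅ 2F ⁆
  ∷ [])

-- Every edge is forced: j₅, j₆, j₇ have degree one and take i₀, i₁, i₂, which leaves one choice
-- each for j₂, j₃, j₄, and then for j₀, j₁.
perfect : Edges 8 8
perfect = (5F , 0F) ∷ (6F , 1F) ∷ (7F , 2F) ∷ (3F , 3F) ∷ (4F , 4F)
        ∷ (0F , 5F) ∷ (1F , 6F) ∷ (2F , 7F) ∷ []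

perfect-isMatching : IsMatching hard perfect
perfect-isMatching = from-yes
  (All.all? (λ (i , j) → i ∈? hard j) perfect ×-dec
   unique? (map proj₁ perfect) ×-dec unique? (map proj₂ perfect))
  where open DecUnique Fin._≟_ using (unique?)

ν-hard : IsMaximumMatchingSize hard 8
ν-hard = (perfect , perfect-isMatching , refl) , matching-size≤l hard

lexicographic-on-hard :
  length (matching (run (lexicographic {1} {2}) (arrivals hard idₚ))) ≡ 5
-- All eight arrivals are evaluated by normalising the decision procedures.
lexicographic-on-hard = refl

lexicographic-ratio : CompetitiveRatioAtMost (lexicographic {1} {2}) (+ 5 / 8)
lexicographic-ratio ρ guarantee =
  -- The guarantee reads ρ · 8 ≤ 5, and 5 is 5/8 · 8 by computation.
  ℚ.*-cancelʳ-≤-pos (+ 8 / 1)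
    (subst (λ n → ρ ℚ.* (+ 8 / 1) ℚ.≤ + n / 1) lexicographic-on-hard
      (guarantee hard idₚ 8 ν-hard))

proposition30 : (∃ λ (A : Algorithm 1 2) → DirectFirst A × CompetitiveRatioAtMost A (+ 5 / 8)) ×
    γ 2 ≡ + 7 / 11 ×
    ¬ (∀ (A : Algorithm 1 2) → DirectFirst A → Guarantees A (γ 2))
proposition30 =
  (lexicographic , lexicographic-directFirst , lexicographic-ratio) ,
  refl ,
  -- 7/11 exceeds 5/8 because 7 · 8 = 56 > 55 = 5 · 11.
  λ guarantee → from-no (γ 2 ℚ.≤? + 5 / 8)
    (lexicographic-ratio (γ 2) (guarantee lexicographic lexicographic-directFirst))
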